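{- Let $n>2$ and $t>2$ be two positive integers. Then \[\varphi(P_n\boxdot C_t)=\begin{cases} 4, & \text{if } (n,t)=(3,4),\\ 5, & \text{if either } (n=3 \text{ and } t\neq 4) \text{ or } n\in\{4,5\},\\ n-1, & \text{if } 6\leq n\leq 2t+3,\\ 2t+3, & \text{otherwise}. \end{cases}\]
   Context: All graphs are finite and simple. $P_n$ and $C_n$ denote respectively the path and the cycle with $n$ vertices. The subdivision graph $S(G)$ of a graph $G$ is obtained by inserting one new vertex into every edge of $G$. For graphs $G$ and $H$, with $V(G)=\{u_0,\ldots,u_{m-1}\}$, the subdivision-vertex neighbourhood corona (SVN corona) $G\boxdot H$ is the graph obtained from $S(G)$ by adding $m$ vertex-disjoint copies of $H$ (one for each $u_i$) and joining, for each $i$, every vertex of $N_{S(G)}(u_i)$ (the neighbourhood of $u_i$ in $S(G)$) to every vertex of the copy of $H$ associated with $u_i$. A $b$-chromatic coloring of a graph with $k$ colors is a proper coloring with colors $0,\ldots,k-1$ such that, for each color $i$, there is a vertex (a $b$-vertex) of color $i$ having, for each color $j\neq i$, a neighbour of color $j$. The $b$-chromatic number $\varphi(G)$ is the maximum $k$ for which $G$ has a $b$-chromatic coloring with $k$ colors. -}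

module Defs where

open import Data.Nat using (ℕ; suc; _≤_; _<_; s≤s)
open import Data.Nat.Properties using (1+n≢n) renaming (_≟_ to _≟ℕ_)
open import Data.Fin using (Fin; toℕ) renaming (_<_ to _<ᶠ_)
open import Data.Fin.Properties using (_≟_)
open import Data.Product using (_×_; _,_; ∃; ∃-syntax)
open import Data.Sum using (_⊎_; inj₁; inj₂; swap)
open import Data.Empty using (⊥)
open import Level using (0ℓ)
open import Relation.Binary using (Rel; Symmetric; Decidable)
open import Relation.Binary.PropositionalEquality using (_≡_; _≢_; refl; sym)
open import Relation.Nullary using (¬_; no)
open import Relation.Nullary.Decidable using (_×-dec_; _⊎-dec_)

record SimpleGraph (V : Set) : Set₁ where
  field
    _∼_        : Rel V 0ℓ
    _∼?_       : Decidable _∼_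
    symmetric  : Symmetric _∼_
    loopless   : ∀ {v} → ¬ (v ∼ v)

open SimpleGraph

Consecutive : ∀ {n} → Rel (Fin n) 0ℓ
Consecutive i j = suc (toℕ i) ≡ toℕ j

path : ∀ n → SimpleGraph (Fin n)
path n ._∼_ i j = Consecutive i j ⊎ Consecutive j i
path n ._∼?_ i j = (suc (toℕ i) ≟ℕ toℕ j) ⊎-dec (suc (toℕ j) ≟ℕ toℕ i)
path n .symmetric = swap
path n .loopless (inj₁ e) = 1+n≢n e
path n .loopless (inj₂ e) = 1+n≢n e

LastFirst : ∀ {n} → Rel (Fin n) 0ℓ
LastFirst {n} i j = suc (toℕ i) ≡ n × toℕ j ≡ 0

cycle : ∀ n → 2 < n → SimpleGraph (Fin n)
cycle n _ ._∼_ i j = _∼_ (path n) i j ⊎ (LastFirst i j ⊎ LastFirst j i)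
cycle n _ ._∼?_ i j = _∼?_ (path n) i j ⊎-dec (lastFirst? i j ⊎-dec lastFirst? j i)
  where
  lastFirst? : Decidable (LastFirst {n})
  lastFirst? i j = (suc (toℕ i) ≟ℕ n) ×-dec (toℕ j ≟ℕ 0)
cycle n _ .symmetric (inj₁ p) = inj₁ (symmetric (path n) p)
cycle n _ .symmetric (inj₂ w) = inj₂ (swap w)
cycle n 2<n .loopless {v} = λ where
    (inj₁ p)        → loopless (path n) {v} p
    (inj₂ (inj₁ w)) → noWrap 2<n w
    (inj₂ (inj₂ w)) → noWrap 2<n w
  where
  noWrap : ∀ {k m} → 2 < m → ¬ (suc k ≡ m × k ≡ 0)
  noWrap (s≤s ()) (refl , refl)

-- An unordered pair of adjacent vertices, represented with its endpoints in
-- increasing order.  The proofs are irrelevant so that an edge is determined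
-- by its endpoints; they can be recovered because both relations are decidable.
record Edge {m} (G : SimpleGraph (Fin m)) : Set where
  constructor edge
  field
    source target : Fin m
    .source<target : source <ᶠ target
    .adjacent      : _∼_ G source target

open Edge

_EndpointOf_ : ∀ {m} {G : SimpleGraph (Fin m)} → Fin m → Edge G → Set
i EndpointOf e = i ≡ source e ⊎ i ≡ target e

endpoint? : ∀ {m} {G : SimpleGraph (Fin m)} → Decidable (_EndpointOf_ {G = G})
endpoint? i e = (i ≟ source e) ⊎-dec (i ≟ target e)

data SubdivisionVertex {m} (G : SimpleGraph (Fin m)) : Set where
  original : Fin m → SubdivisionVertex G
  inserted : Edge G → SubdivisionVertex G

subdivision : ∀ {m} (G : SimpleGraph (Fin m)) → SimpleGraph (SubdivisionVertex G)
subdivision G ._∼_ (original i) (inserted e) = i EndpointOf e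
subdivision G ._∼_ (inserted e) (original i) = i EndpointOf e
subdivision G ._∼_ (original _) (original _) = ⊥
subdivision G ._∼_ (inserted _) (inserted _) = ⊥
subdivision G ._∼?_ (original i) (inserted e) = endpoint? i e
subdivision G ._∼?_ (inserted e) (original i) = endpoint? i e
subdivision G ._∼?_ (original _) (original _) = no λ ()
subdivision G ._∼?_ (inserted _) (inserted _) = no λ ()
subdivision G .symmetric {original _} {inserted _} p = p
subdivision G .symmetric {inserted _} {original _} p = p
subdivision G .loopless {original _} ()
subdivision G .loopless {inserted _} ()

data CoronaVertex {m} (G : SimpleGraph (Fin m)) (W : Set) : Set where
  base : SubdivisionVertex G → CoronaVertex G W
  copy : Fin m → W → CoronaVertex G W

-- The subdivision-vertex neighbourhood corona; copy i w is the vertex w in the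
-- copy of H associated with the i-th vertex of G.
infix 6 _⊡_
_⊡_ : ∀ {m} {W : Set} (G : SimpleGraph (Fin m)) → SimpleGraph W →
      SimpleGraph (CoronaVertex G W)
(G ⊡ H) ._∼_ (base x)   (base y)   = _∼_ (subdivision G) x y
(G ⊡ H) ._∼_ (base x)   (copy i _) = _∼_ (subdivision G) (original i) x
(G ⊡ H) ._∼_ (copy i _) (base x)   = _∼_ (subdivision G) (original i) x
(G ⊡ H) ._∼_ (copy i v) (copy j w) = i ≡ j × _∼_ H v w
(G ⊡ H) ._∼?_ (base x)   (base y)   = _∼?_ (subdivision G) x y
(G ⊡ H) ._∼?_ (base x)   (copy i _) = _∼?_ (subdivision G) (original i) x
(G ⊡ H) ._∼?_ (copy i _) (base x)   = _∼?_ (subdivision G) (original i) x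
(G ⊡ H) ._∼?_ (copy i v) (copy j w) = (i ≟ j) ×-dec _∼?_ H v w
(G ⊡ H) .symmetric {base x}   {base y}   p = symmetric (subdivision G) {x} {y} p
(G ⊡ H) .symmetric {base _}   {copy _ _} p = p
(G ⊡ H) .symmetric {copy _ _} {base _}   p = p
(G ⊡ H) .symmetric {copy _ _} {copy _ _} (i≡j , p) = sym i≡j , symmetric H p
(G ⊡ H) .loopless {base x}   p       = loopless (subdivision G) {x} p
(G ⊡ H) .loopless {copy _ _} (_ , p) = loopless H p

module _ {V : Set} (G : SimpleGraph V) {k : ℕ} (c : V → Fin k) where

  Proper : Set
  Proper = ∀ {v w} → _∼_ G v w → c v ≢ c w

  BVertex : Fin k → V → Set
  BVertex i v = c v ≡ i × (∀ j → j ≢ i → ∃[ w ] (_∼_ G v w × c w ≡ j))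

  BChromaticColoring : Set
  BChromaticColoring = Proper × (∀ i → ∃ (BVertex i))

HasBChromaticColoring : ∀ {V} → SimpleGraph V → ℕ → Set
HasBChromaticColoring {V} G k = ∃[ c ] BChromaticColoring G {k} c

-- φ is defined as a maximum, stated as a relation: φ G ≐ k says that the
-- maximum exists and is k.
infix 4 φ_≐_
φ_≐_ : ∀ {V} → SimpleGraph V → ℕ → Set
φ G ≐ k = HasBChromaticColoring G k × (∀ l → HasBChromaticColoring G l → l ≤ k)

{-# OPTIONS --safe #-}
module Submission where

-- Only the n − 1 subdivision vertices e_i (joining u_i and u_{i+1}) have degree above 4, namely 2t + 2;
-- hence k colours with k ≥ 6 force k ≤ min(n − 1, 2t + 3).  For n = 3 and t = 4, antipodal vertices of
-- the middle copy are twins, so b-vertices among them share a colour and 5 colours are impossible.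
--
-- Conversely let K = 2h + 1 with h ≤ t + 1, let e_i get colour i mod K, and let the block of i (u_i and
-- its cycle) use exactly the h colours i + 1, i + 3, …, i + 2h − 1 mod K.  Relative to the colour of e_i,
-- the blocks i and i + 1 realise the odd and the even nonzero residues, so e_0, …, e_{K−1} are b-vertices
-- of all K colours.  For K − 1 colours, the colour K − 1 = 2h does not occur on an edge (then n − 1 = 2h),
-- and where it occurs in block i it is replaced by i + 2 mod K, which is new to that block.

open import Defs
open import Data.Bool using (if_then_else_)
open import Data.Empty using (⊥; ⊥-elim)
open import Data.Fin using (Fin; zero; suc; toℕ; fromℕ<; combine; remQuot; join; splitAt; #_)
open import Data.Fin.Properties using (injective⇒≤; remQuot-combine; toℕ-injective; toℕ<n;
  toℕ-fromℕ<; fromℕ<-injective; all?; splitAt-join) renaming (_≟_ to _≟ᶠ_)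
open import Data.Nat using (ℕ; zero; suc; pred; _+_; _*_; _∸_; _≤_; _<_; z≤n; s≤s; z<s; s≤s⁻¹;
  _≤?_; _<?_; _≟_)
open import Data.Nat.DivMod using (_mod_; _%_; %-distribˡ-+; [m+kn]%n≡m%n; m<n⇒m%n≡m; m%n<n;
  [m+n]%n≡m%n)
open import Data.Nat.Properties using (*-cancelˡ-<; *-cancelˡ-≡; *-cancelˡ-≤; *-monoʳ-≤; *-suc;
  +-comm; +-identityʳ; +-monoˡ-≤; +-suc; 1+n≢n; <-cmp; <⇒≢; <⇒≤; <⇒≯; even≢odd; m<n⇒m<1+n;
  m≤m+n; m≤n+m; m≤n⇒m<n∨m≡n; m≤n⇒m≤1+n; m≤n⇒∃[o]m+o≡n; n≤1+n; pred[n]≤n; suc-injective;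
  ≤-<-trans; ≤-antisym; ≤-refl; ≤-reflexive; ≤-trans; ≤∧≢⇒<; ≮⇒≥; ≰⇒>)
open import Data.Nat.Tactic.RingSolver using (solve-∀)
open import Data.Product using (_×_; _,_; ∃; ∃-syntax; proj₁; proj₂; uncurry)
open import Data.Sum using (_⊎_; inj₁; inj₂; [_,_]′)
open import Data.Sum.Properties using (inj₁-injective; inj₂-injective)
open import Function using (_∘_)
open import Relation.Binary using (tri<; tri≈; tri>)
open import Relation.Binary.PropositionalEquality using (_≡_; _≢_; refl; sym; trans; cong; cong₂;
  subst; ≢-sym; module ≡-Reasoning)
open import Relation.Nullary using (¬_; yes; no; contradiction)
open import Relation.Nullary.Decidable using (⌊_⌋; _×-dec_; _⊎-dec_; ¬?; _→-dec_; from-yes; recompute)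

open SimpleGraph
open Edge

-- Degree bounds and domination for b-vertices.

record DegreeAtMost {V : Set} (G : SimpleGraph V) (v : V) (d : ℕ) : Set₁ where
  field
    -- Slots are predicates rather than vertices because a slot may stay empty, as for a missing
    -- edge at an end of the path.
    Slot        : Fin d → V → Set
    slot        : ∀ {w} → _∼_ G v w → ∃[ a ] Slot a w
    slot-unique : ∀ {a w w′} → Slot a w → Slot a w′ → w ≡ w′

module _ {V : Set} (G : SimpleGraph V) {k : ℕ} {c : V → Fin k} where

  -- The colour `i` goes to `zero` and every other colour to the slot of a neighbour that carries
  -- it. A slot holds one vertex and a vertex has one colour, so this is injective.
  bVertex-degree : ∀ {i v d} → DegreeAtMost G v d → BVertex G c i v → k ≤ suc d
  bVertex-degree {i} {v} {d} D (_ , reach) = injective⇒≤ {f = f} (f-injective _ _)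
    where
    open DegreeAtMost D
    f : Fin k → Fin (suc d)
    f j with j ≟ᶠ i
    ... | yes _ = zero
    ... | no j≢i = suc (proj₁ (slot (proj₁ (proj₂ (reach j j≢i)))))
    f-injective : ∀ j j′ → f j ≡ f j′ → j ≡ j′
    f-injective j j′ eq with j ≟ᶠ i | j′ ≟ᶠ i
    ... | yes refl | yes refl = refl
    ... | no j≢i | no j′≢i with reach j j≢i | reach j′ j′≢i
    ...   | w , v∼w , refl | w′ , v∼w′ , refl with slot v∼w | slot v∼w′
    ...     | a , s | a′ , s′ with eq
    ...       | refl = cong c (slot-unique s s′)

  -- If `v′` had another colour, `v` would have a neighbour of that colour, which would also be a
  -- neighbour of `v′`.
  dominated-colour : ∀ {i v v′} → Proper G c → BVertex G c i v →
    (∀ {w} → _∼_ G v w → _∼_ G v′ w) → c v′ ≡ i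
  dominated-colour {i} {v} {v′} proper (_ , reach) N⊆N′ with c v′ ≟ᶠ i
  ... | yes eq = eq
  ... | no c≢i with reach (c v′) c≢i
  ...   | w , v∼w , cw≡ = contradiction (sym cw≡) (proper (N⊆N′ v∼w))

-- Edges of a path, determined by either endpoint.

edge-irrelevant : ∀ {m} {G : SimpleGraph (Fin m)} {e e′ : Edge G} →
  source e ≡ source e′ → target e ≡ target e′ → e ≡ e′
edge-irrelevant refl refl = refl

module _ {n : ℕ} where

  target≡1+source : (e : Edge (path n)) → suc (toℕ (source e)) ≡ toℕ (target e)
  -- The proofs inside an edge are irrelevant; deciding the equation between naturals recovers a
  -- usable one.
  target≡1+source (edge s t s<t s∼t) = recompute (suc (toℕ s) ≟ toℕ t) (consecutive s<t s∼t)
    where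
    consecutive : toℕ s < toℕ t → _∼_ (path n) s t → suc (toℕ s) ≡ toℕ t
    consecutive _   (inj₁ eq) = eq
    consecutive s<t (inj₂ eq) = contradiction (≤-reflexive eq) (<⇒≯ s<t)

  source-injective : {e e′ : Edge (path n)} → source e ≡ source e′ → e ≡ e′
  source-injective {e} {e′} eq = edge-irrelevant eq (toℕ-injective
    (trans (sym (target≡1+source e)) (trans (cong (suc ∘ toℕ) eq) (target≡1+source e′))))

  target-injective : {e e′ : Edge (path n)} → target e ≡ target e′ → e ≡ e′
  target-injective {e} {e′} eq = source-injective (toℕ-injective (cong pred
    (trans (target≡1+source e) (trans (cong toℕ eq) (sym (target≡1+source e′))))))

  source-bound : (e : Edge (path n)) → suc (toℕ (source e)) < n
  source-bound e = subst (_< n) (sym (target≡1+source e)) (toℕ<n (target e))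

edge-index : ∀ {n} → Edge (path (suc n)) → Fin n
edge-index e = fromℕ< (s≤s⁻¹ (source-bound e))

edge-index-injective : ∀ {n} {e e′ : Edge (path (suc n))} → edge-index e ≡ edge-index e′ → e ≡ e′
edge-index-injective eq = source-injective (toℕ-injective (fromℕ<-injective _ _ _ _ eq))

-- Degrees in the corona of a path and a cycle.

module _ {n t : ℕ} {2<t : 2 < t} where

  private
    G = path n ⊡ cycle t 2<t
    V = CoronaVertex (path n) (Fin t)

  _NextTo_ : Fin t → Fin t → Set
  v NextTo w = Consecutive v w ⊎ LastFirst v w

  next-unique : ∀ {v w w′} → v NextTo w → v NextTo w′ → w ≡ w′
  next-unique (inj₁ p) (inj₁ q) = toℕ-injective (trans (sym p) q)
  next-unique {w = w} (inj₁ p) (inj₂ (q , _)) = contradiction (trans (sym p) q) (<⇒≢ (toℕ<n w))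
  next-unique {w′ = w} (inj₂ (q , _)) (inj₁ p) = contradiction (trans (sym p) q) (<⇒≢ (toℕ<n w))
  next-unique (inj₂ (_ , p)) (inj₂ (_ , q)) = toℕ-injective (trans p (sym q))

  previous-unique : ∀ {v v′ w} → v NextTo w → v′ NextTo w → v ≡ v′
  previous-unique (inj₁ p) (inj₁ q) = toℕ-injective (cong pred (trans p (sym q)))
  previous-unique (inj₁ p) (inj₂ (_ , q)) = contradiction (trans p q) λ ()
  previous-unique (inj₂ (_ , q)) (inj₁ p) = contradiction (trans p q) λ ()
  previous-unique (inj₂ (p , _)) (inj₂ (q , _)) = toℕ-injective (cong pred (trans p (sym q)))

  EdgeFrom EdgeInto : Fin n → V → Set
  EdgeFrom i w = ∃[ e ] (w ≡ base (inserted e) × source e ≡ i)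
  EdgeInto i w = ∃[ e ] (w ≡ base (inserted e) × target e ≡ i)

  edgeFrom-unique : ∀ {i w w′} → EdgeFrom i w → EdgeFrom i w′ → w ≡ w′
  edgeFrom-unique (_ , refl , p) (_ , refl , q) =
    cong (base ∘ inserted) (source-injective (trans p (sym q)))

  edgeInto-unique : ∀ {i w w′} → EdgeInto i w → EdgeInto i w′ → w ≡ w′
  edgeInto-unique (_ , refl , p) (_ , refl , q) =
    cong (base ∘ inserted) (target-injective (trans p (sym q)))

  NextIn PreviousIn : Fin n → Fin t → V → Set
  NextIn i v w = ∃[ x ] (w ≡ copy i x × v NextTo x)
  PreviousIn i v w = ∃[ x ] (w ≡ copy i x × x NextTo v)

  nextIn-unique : ∀ {i v w w′} → NextIn i v w → NextIn i v w′ → w ≡ w′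
  nextIn-unique (_ , refl , p) (_ , refl , q) = cong (copy _) (next-unique p q)

  previousIn-unique : ∀ {i v w w′} → PreviousIn i v w → PreviousIn i v w′ → w ≡ w′
  previousIn-unique (_ , refl , p) (_ , refl , q) = cong (copy _) (previous-unique p q)

  original-degree : ∀ i → DegreeAtMost G (base (original i)) 2
  original-degree i = record
    { Slot = Slot
    ; slot = λ {w} → slot w
    ; slot-unique = λ {a} → unique a
    }
    where
    Slot : Fin 2 → V → Set
    Slot zero       = EdgeFrom i
    Slot (suc zero) = EdgeInto i
    slot : ∀ w → _∼_ G (base (original i)) w → ∃[ a ] Slot a w
    slot (base (inserted e)) (inj₁ eq) = zero , e , refl , sym eq
    slot (base (inserted e)) (inj₂ eq) = suc zero , e , refl , sym eq
    unique : ∀ a {w w′} → Slot a w → Slot a w′ → w ≡ w′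
    unique zero       = edgeFrom-unique
    unique (suc zero) = edgeInto-unique

  copy-degree : ∀ i v → DegreeAtMost G (copy i v) 4
  copy-degree i v = record
    { Slot = Slot
    ; slot = λ {w} → slot w
    ; slot-unique = λ {a} → unique a
    }
    where
    Slot : Fin 4 → V → Set
    Slot zero                   = EdgeFrom i
    Slot (suc zero)             = EdgeInto i
    Slot (suc (suc zero))       = NextIn i v
    Slot (suc (suc (suc zero))) = PreviousIn i v
    slot : ∀ w → _∼_ G (copy i v) w → ∃[ a ] Slot a w
    slot (base (inserted e)) (inj₁ eq) = zero , e , refl , sym eq
    slot (base (inserted e)) (inj₂ eq) = suc zero , e , refl , sym eq
    slot (copy _ w) (refl , inj₁ (inj₁ p)) = suc (suc zero) , w , refl , inj₁ p
    slot (copy _ w) (refl , inj₁ (inj₂ p)) = suc (suc (suc zero)) , w , refl , inj₁ p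
    slot (copy _ w) (refl , inj₂ (inj₁ p)) = suc (suc zero) , w , refl , inj₂ p
    slot (copy _ w) (refl , inj₂ (inj₂ p)) = suc (suc (suc zero)) , w , refl , inj₂ p
    unique : ∀ a {w w′} → Slot a w → Slot a w′ → w ≡ w′
    unique zero                   = edgeFrom-unique
    unique (suc zero)             = edgeInto-unique
    unique (suc (suc zero))       = nextIn-unique
    unique (suc (suc (suc zero))) = previousIn-unique

  -- An end of the path lies on one edge only, so the edge leaving `i` and the edge entering `i` can
  -- share a slot: `one-sided` shows that they never both exist.
  end-degree : ∀ i v → toℕ i ≡ 0 ⊎ suc (toℕ i) ≡ n → DegreeAtMost G (copy i v) 3
  end-degree i v end = record
    { Slot = Slot
    ; slot = λ {w} → slot w
    ; slot-unique = λ {a} → unique a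
    }
    where
    Slot : Fin 3 → V → Set
    Slot zero             w = EdgeFrom i w ⊎ EdgeInto i w
    Slot (suc zero)       w = NextIn i v w
    Slot (suc (suc zero)) w = PreviousIn i v w
    slot : ∀ w → _∼_ G (copy i v) w → ∃[ a ] Slot a w
    slot (base (inserted e)) (inj₁ eq) = zero , inj₁ (e , refl , sym eq)
    slot (base (inserted e)) (inj₂ eq) = zero , inj₂ (e , refl , sym eq)
    slot (copy _ w) (refl , inj₁ (inj₁ p)) = suc zero , w , refl , inj₁ p
    slot (copy _ w) (refl , inj₁ (inj₂ p)) = suc (suc zero) , w , refl , inj₁ p
    slot (copy _ w) (refl , inj₂ (inj₁ p)) = suc zero , w , refl , inj₂ p
    slot (copy _ w) (refl , inj₂ (inj₂ p)) = suc (suc zero) , w , refl , inj₂ p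
    one-sided : ∀ {w w′} → EdgeFrom i w → EdgeInto i w′ → ⊥
    one-sided (e , _ , p) (e′ , _ , q) =
      [ (λ first → contradiction (trans (target≡1+source e′) (trans (cong toℕ q) first)) λ ())
      , (λ last → <⇒≢ (source-bound e) (trans (cong (suc ∘ toℕ) p) last)) ]′ end
    unique : ∀ a {w w′} → Slot a w → Slot a w′ → w ≡ w′
    unique zero (inj₁ p) (inj₁ q) = edgeFrom-unique p q
    unique zero (inj₁ p) (inj₂ q) = ⊥-elim (one-sided p q)
    unique zero (inj₂ p) (inj₁ q) = ⊥-elim (one-sided q p)
    unique zero (inj₂ p) (inj₂ q) = edgeInto-unique p q
    unique (suc zero)       = nextIn-unique
    unique (suc (suc zero)) = previousIn-unique

  blockVertex : Fin n → Fin (suc t) → V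
  blockVertex i zero    = base (original i)
  blockVertex i (suc v) = copy i v

  -- The neighbours form two blocks of `suc t` vertices, one per endpoint. A slot number encodes the
  -- endpoint and the position in its block.
  inserted-degree : ∀ e → DegreeAtMost G (base (inserted e)) (2 * suc t)
  inserted-degree e = record
    { Slot = λ a w → uncurry (blockVertex ∘ end) (remQuot (suc t) a) ≡ w
    ; slot = λ {w} → slot w
    ; slot-unique = λ p q → trans (sym p) q
    }
    where
    end : Fin 2 → Fin n
    end zero       = source e
    end (suc zero) = target e
    fromBlock : ∀ b v {w} → blockVertex (end b) v ≡ w →
      ∃[ a ] uncurry (blockVertex ∘ end) (remQuot (suc t) a) ≡ w
    fromBlock b v eq = combine b v ,
      trans (cong (uncurry (blockVertex ∘ end)) (remQuot-combine b v)) eq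
    slot : ∀ w → _∼_ G (base (inserted e)) w →
      ∃[ a ] uncurry (blockVertex ∘ end) (remQuot (suc t) a) ≡ w
    slot (base (original _)) (inj₁ refl) = fromBlock zero zero refl
    slot (base (original _)) (inj₂ refl) = fromBlock (suc zero) zero refl
    slot (copy _ v) (inj₁ refl) = fromBlock zero (suc v) refl
    slot (copy _ v) (inj₂ refl) = fromBlock (suc zero) (suc v) refl

-- Upper bounds.

φ-upper : ∀ {n t} {2<t : 2 < t} l → HasBChromaticColoring (path (suc n) ⊡ cycle t 2<t) l →
  l ≤ 5 ⊎ (l ≤ n × l ≤ 2 * t + 3)
φ-upper {n} {t} {2<t} l (c , _ , bVertex) with l ≤? 5
... | yes l≤5 = inj₁ l≤5
-- With at least six colours only inserted vertices have enough neighbours. Distinct colours then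
-- need distinct edges, and `path (suc n)` has `n` of them.
... | no  l≰5 = inj₂ (injective⇒≤ {f = edge-index ∘ bEdge} bEdge-injective , degree-bound)
  where
  G = path (suc n) ⊡ cycle t 2<t
  isEdge : ∀ i → ∃[ e ] BVertex G c i (base (inserted e))
  isEdge i with bVertex i
  ... | base (original u) , b =
    contradiction (≤-trans (bVertex-degree G (original-degree u) b) (m≤m+n 3 2)) l≰5
  ... | base (inserted e) , b = e , b
  ... | copy u v , b = contradiction (bVertex-degree G (copy-degree u v) b) l≰5
  bEdge : Fin l → Edge (path (suc n))
  bEdge i = proj₁ (isEdge i)
  bEdge-injective : ∀ {i j} → edge-index (bEdge i) ≡ edge-index (bEdge j) → i ≡ j
  bEdge-injective {i} {j} eq = trans (sym (proj₁ (proj₂ (isEdge i))))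
    (trans (cong (c ∘ base ∘ inserted) (edge-index-injective eq)) (proj₁ (proj₂ (isEdge j))))
  degree-bound : l ≤ 2 * t + 3
  degree-bound = subst (l ≤_) (slots t)
    (bVertex-degree G (inserted-degree _) (proj₂ (isEdge (fromℕ< (≤-trans z<s (≰⇒> l≰5))))))
    where
    slots : ∀ t → suc (2 * suc t) ≡ 2 * t + 3
    slots = solve-∀

-- Beyond four colours, b-vertices are the two inserted vertices or lie in the middle copy, where
-- each antipodal pair counts once. These are four classes, and b-vertices of one class share a
-- colour.
φ-upper-3-4 : ∀ {2<4 : 2 < 4} l → HasBChromaticColoring (path 3 ⊡ cycle 4 2<4) l → l ≤ 4
φ-upper-3-4 {2<4} l (c , proper , bVertex) with l ≤? 4
... | yes l≤4 = l≤4
... | no  l≰4 = injective⇒≤ {f = join 2 2 ∘ class ∘ bv} (class-injective ∘ join-injective)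
  where
  G = path 3 ⊡ cycle 4 2<4
  bv : Fin l → CoronaVertex (path 3) (Fin 4)
  bv i = proj₁ (bVertex i)
  join-injective : {x y : Fin 2 ⊎ Fin 2} → join 2 2 x ≡ join 2 2 y → x ≡ y
  join-injective {x} {y} eq =
    trans (sym (splitAt-join 2 2 x)) (trans (cong (splitAt 2) eq) (splitAt-join 2 2 y))

  parity : Fin 4 → Fin 2
  parity zero                   = zero
  parity (suc zero)             = suc zero
  parity (suc (suc zero))       = zero
  parity (suc (suc (suc zero))) = suc zero

  -- Meaningful on b-vertices only: these are inserted vertices or lie in the middle copy.
  class : CoronaVertex (path 3) (Fin 4) → Fin 2 ⊎ Fin 2
  class (base (original _)) = inj₁ zero
  class (base (inserted e)) = inj₁ (edge-index e)
  class (copy _ v)          = inj₂ (parity v)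

  data Eligible : CoronaVertex (path 3) (Fin 4) → Set where
    inserted : ∀ e → Eligible (base (inserted e))
    middle   : ∀ v → Eligible (copy (suc zero) v)

  eligible : ∀ {i v} → BVertex G c i v → Eligible v
  eligible {v = base (original u)} b =
    contradiction (≤-trans (bVertex-degree G (original-degree u) b) (m≤m+n 3 1)) l≰4
  eligible {v = base (inserted e)} _ = inserted e
  eligible {v = copy zero v} b =
    contradiction (bVertex-degree G (end-degree zero v (inj₁ refl)) b) l≰4
  eligible {v = copy (suc zero) v} _ = middle v
  eligible {v = copy (suc (suc zero)) v} b =
    contradiction (bVertex-degree G (end-degree (suc (suc zero)) v (inj₂ refl)) b) l≰4

  antipodal-twins : ∀ v w → parity v ≡ parity w →
    ∀ x → _∼_ (cycle 4 2<4) v x → _∼_ (cycle 4 2<4) w x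
  -- Decided by evaluation over all triples of positions.
  antipodal-twins = from-yes (all? λ v → all? λ w → (parity v ≟ᶠ parity w) →-dec
    all? λ x → _∼?_ (cycle 4 2<4) v x →-dec _∼?_ (cycle 4 2<4) w x)

  twins : ∀ {v w} → Eligible v → Eligible w → class v ≡ class w →
    ∀ {x} → _∼_ G v x → _∼_ G w x
  twins (inserted e) (inserted e′) eq {x} = subst (λ e → _∼_ G (base (inserted e)) x)
    (edge-index-injective (inj₁-injective eq))
  -- Outside the cycle, all vertices of a copy have the same neighbours.
  twins (middle v) (middle w) eq {base x}   p          = p
  twins (middle v) (middle w) eq {copy _ x} (refl , p) =
    refl , antipodal-twins v w (inj₂-injective eq) x p

  class-injective : ∀ {i j} → class (bv i) ≡ class (bv j) → i ≡ j
  class-injective {i} {j} eq = trans (sym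
    (dominated-colour G proper b (twins (eligible b) (eligible b′) eq))) (proj₁ b′)
    where
    b  = proj₂ (bVertex i)
    b′ = proj₂ (bVertex j)

-- Colourings prescribed by index functions.

module Scheme {n t k : ℕ} (2<t : 2 < t)
  (edgeC vertexC : ℕ → Fin k) (copyC : ℕ → ℕ → Fin k) where

  G = path n ⊡ cycle t 2<t
  V = CoronaVertex (path n) (Fin t)

  colouring : V → Fin k
  colouring (base (original i)) = vertexC (toℕ i)
  colouring (base (inserted e)) = edgeC (toℕ (source e))
  colouring (copy i v)          = copyC (toℕ i) (toℕ v)

  -- An edge is indexed by its source, so `suc i < n` says that edge `i` exists. The cycle patterns
  -- are infinite sequences, cut off at `t` only by `closing`. Nothing relates `vertexC` to `copyC`,
  -- since u_i is not adjacent to its own copy.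
  record Compatible : Set where
    field
      edge≢vertexˡ : ∀ i → suc i < n → edgeC i ≢ vertexC i
      edge≢vertexʳ : ∀ i → suc i < n → edgeC i ≢ vertexC (suc i)
      edge≢copyˡ   : ∀ i p → suc i < n → edgeC i ≢ copyC i p
      edge≢copyʳ   : ∀ i p → suc i < n → edgeC i ≢ copyC (suc i) p
      consecutive  : ∀ i p → copyC i p ≢ copyC i (suc p)
      closing      : ∀ i p → suc p ≡ t → copyC i p ≢ copyC i 0

    edge≢vertex : ∀ e i → i EndpointOf e → edgeC (toℕ (source e)) ≢ vertexC (toℕ i)
    edge≢vertex e _ (inj₁ refl) = edge≢vertexˡ _ (source-bound e)
    edge≢vertex e _ (inj₂ refl) eq =
      edge≢vertexʳ _ (source-bound e) (trans eq (cong vertexC (sym (target≡1+source e))))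

    edge≢copy : ∀ e i p → i EndpointOf e → edgeC (toℕ (source e)) ≢ copyC (toℕ i) p
    edge≢copy e _ p (inj₁ refl) = edge≢copyˡ _ p (source-bound e)
    edge≢copy e _ p (inj₂ refl) eq = edge≢copyʳ _ p (source-bound e)
      (trans eq (cong (λ i → copyC i p) (sym (target≡1+source e))))

    adjacent≢ : ∀ i {v w} → Consecutive {t} v w → copyC i (toℕ v) ≢ copyC i (toℕ w)
    adjacent≢ i v→w eq = consecutive i _ (trans eq (cong (copyC i) (sym v→w)))

    wrap≢ : ∀ i {v w} → LastFirst {t} v w → copyC i (toℕ v) ≢ copyC i (toℕ w)
    wrap≢ i (last , first) eq = closing i _ last (trans eq (cong (copyC i) first))

    proper : Proper G colouring
    proper {base (original i)} {base (inserted e)} p = ≢-sym (edge≢vertex e i p)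
    proper {base (inserted e)} {base (original i)} p = edge≢vertex e i p
    proper {base (inserted e)} {copy i v} p = edge≢copy e i _ p
    proper {copy i v} {base (inserted e)} p = ≢-sym (edge≢copy e i _ p)
    proper {copy i v} {copy _ w} (refl , inj₁ (inj₁ p)) = adjacent≢ (toℕ i) p
    proper {copy i v} {copy _ w} (refl , inj₁ (inj₂ p)) = ≢-sym (adjacent≢ (toℕ i) p)
    proper {copy i v} {copy _ w} (refl , inj₂ (inj₁ p)) = wrap≢ (toℕ i) p
    proper {copy i v} {copy _ w} (refl , inj₂ (inj₂ p)) = ≢-sym (wrap≢ (toℕ i) p)

  Sees : V → Fin k → Set
  Sees v j = ∃[ w ] (_∼_ G v w × colouring w ≡ j)

  edgeAt : ∀ i → suc i < n → Edge (path n)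
  edgeAt i b = edge (fromℕ< (<⇒≤ b)) (fromℕ< b)
    (≤-reflexive (trans (cong suc (toℕ-fromℕ< _)) (sym (toℕ-fromℕ< _))))
    (inj₁ (trans (cong suc (toℕ-fromℕ< _)) (sym (toℕ-fromℕ< _))))

  edgeVertex : ∀ i → suc i < n → V
  edgeVertex i b = base (inserted (edgeAt i b))

  copyVertex : ∀ i p → i < n → p < t → V
  copyVertex i p i<n p<t = copy (fromℕ< i<n) (fromℕ< p<t)

  edge-colour : ∀ i b → colouring (edgeVertex i b) ≡ edgeC i
  edge-colour i b = cong edgeC (toℕ-fromℕ< _)

  copy-colour : ∀ i p i<n p<t → colouring (copyVertex i p i<n p<t) ≡ copyC i p
  copy-colour i p i<n p<t = cong₂ copyC (toℕ-fromℕ< _) (toℕ-fromℕ< _)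

  endpoint-bound : ∀ {i x} → suc i < n → x ≡ i ⊎ x ≡ suc i → x < n
  endpoint-bound b (inj₁ refl) = <⇒≤ b
  endpoint-bound b (inj₂ refl) = b

  endpoint : ∀ {i x} b (x∈i : x ≡ i ⊎ x ≡ suc i) → fromℕ< (endpoint-bound b x∈i) EndpointOf edgeAt i b
  endpoint b (inj₁ refl) = inj₁ refl
  endpoint b (inj₂ refl) = inj₂ refl

  edge-sees-vertex : ∀ {i x} b → x ≡ i ⊎ x ≡ suc i → Sees (edgeVertex i b) (vertexC x)
  edge-sees-vertex b x∈i = base (original (fromℕ< (endpoint-bound b x∈i))) ,
    endpoint b x∈i , cong vertexC (toℕ-fromℕ< _)

  edge-sees-copy : ∀ {i x p} b → x ≡ i ⊎ x ≡ suc i → p < t → Sees (edgeVertex i b) (copyC x p)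
  edge-sees-copy b x∈i p<t = copyVertex _ _ (endpoint-bound b x∈i) p<t ,
    endpoint b x∈i , copy-colour _ _ (endpoint-bound b x∈i) p<t

  copy-sees-edge : ∀ {i x p} x<n p<t → suc i < n → x ≡ i ⊎ x ≡ suc i →
    Sees (copyVertex x p x<n p<t) (edgeC i)
  copy-sees-edge _ _ b x∈i = edgeVertex _ b , endpoint b x∈i , edge-colour _ b

  copy-sees-next : ∀ {i p} i<n p<t → suc p < t → Sees (copyVertex i p i<n p<t) (copyC i (suc p))
  copy-sees-next i<n _ p+1<t = copyVertex _ _ i<n p+1<t ,
    (refl , inj₁ (inj₁ (trans (cong suc (toℕ-fromℕ< _)) (sym (toℕ-fromℕ< _))))) ,
    copy-colour _ _ i<n p+1<t

  copy-sees-previous : ∀ {i p} i<n p+1<t → Sees (copyVertex i (suc p) i<n p+1<t) (copyC i p)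
  copy-sees-previous i<n p+1<t = copyVertex _ _ i<n (<⇒≤ p+1<t) ,
    (refl , inj₁ (inj₂ (trans (cong suc (toℕ-fromℕ< _)) (sym (toℕ-fromℕ< _))))) ,
    copy-colour _ _ i<n (<⇒≤ p+1<t)

  copy-sees-first : ∀ {i p} i<n p<t → suc p ≡ t → Sees (copyVertex i p i<n p<t) (copyC i 0)
  copy-sees-first i<n _ last = copyVertex _ _ i<n (≤-trans z<s 2<t) ,
    (refl , inj₂ (inj₁ (trans (cong suc (toℕ-fromℕ< _)) last , toℕ-fromℕ< _))) ,
    copy-colour _ _ i<n (≤-trans z<s 2<t)

  copy-sees-last : ∀ {i p} i<n 0<t → suc p ≡ t → Sees (copyVertex i 0 i<n 0<t) (copyC i p)
  copy-sees-last i<n _ last = copyVertex _ _ i<n (≤-reflexive last) ,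
    (refl , inj₂ (inj₂ (trans (cong suc (toℕ-fromℕ< _)) last , toℕ-fromℕ< _))) ,
    copy-colour _ _ i<n (≤-reflexive last)

-- Cycle patterns from three colours.

-- The sequence a, b, c, b, c, ...: if a differs from b and c it never returns, so the pattern
-- closes up properly for either parity of the cycle length.
alternating : {A : Set} → A → A → A → ℕ → A
alternating a b c zero    = a
alternating a b c (suc p) = alternating b c b p

module _ {A : Set} where

  alternating-avoids : ∀ {a b c d : A} → d ≢ a → d ≢ b → d ≢ c → ∀ p → d ≢ alternating a b c p
  alternating-avoids d≢a d≢b d≢c zero    = d≢a
  alternating-avoids d≢a d≢b d≢c (suc p) = alternating-avoids d≢b d≢c d≢b p

  alternating-consecutive : ∀ {a b c : A} → a ≢ b → b ≢ c →
    ∀ p → alternating a b c p ≢ alternating a b c (suc p)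
  alternating-consecutive a≢b b≢c zero    = a≢b
  alternating-consecutive a≢b b≢c (suc p) = alternating-consecutive b≢c (≢-sym b≢c) p

  alternating-closing : ∀ {a b c : A} {t} → 2 < t → a ≢ b → a ≢ c →
    ∀ p → suc p ≡ t → alternating a b c p ≢ a
  alternating-closing 2<t a≢b a≢c zero    refl = contradiction 2<t λ { (s≤s ()) }
  alternating-closing 2<t a≢b a≢c (suc p) _    = ≢-sym (alternating-avoids a≢b a≢c a≢b p)

private
  left : {i : ℕ} → i ≡ i ⊎ i ≡ suc i
  left = inj₁ refl
  right : {i : ℕ} → suc i ≡ i ⊎ suc i ≡ suc i
  right = inj₂ refl

-- Five colours on short paths.

module _ {t : ℕ} (2<t : 2 < t) where

  private
    0<t = ≤-trans z<s 2<t
    1<t = <⇒≤ 2<t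

  module FiveColours (m : ℕ) where

    -- Edges 0, 1, 2 serve as b-vertices of their own colours. Position 1 in the copies 1 and 2
    -- serves for colours 3 and 4: its two edges and two cycle neighbours show the four other
    -- colours. Apart from `vertexC 3`, which shows colour 1 to edge 2, the default clauses only
    -- keep the rest of the path proper.
    edgeC vertexC : ℕ → Fin 5
    edgeC 0 = # 0
    edgeC 1 = # 1
    edgeC 2 = # 2
    edgeC _ = # 0
    vertexC 0 = # 1
    vertexC 1 = # 3
    vertexC 2 = # 3
    vertexC _ = # 1
    copyC : ℕ → ℕ → Fin 5
    copyC 0 = alternating (# 2) (# 3) (# 4)
    copyC 1 = alternating (# 2) (# 3) (# 4)
    copyC 2 = alternating (# 0) (# 4) (# 3)
    copyC _ = alternating (# 1) (# 3) (# 4)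

    open Scheme {4 + m} 2<t edgeC vertexC copyC

    compatible : Compatible
    compatible = record
      { edge≢vertexˡ = λ where
          0 _ () ; 1 _ () ; 2 _ () ; (suc (suc (suc i))) _ ()
      ; edge≢vertexʳ = λ where
          0 _ () ; 1 _ () ; 2 _ () ; (suc (suc (suc i))) _ ()
      ; edge≢copyˡ = λ where
          0 p _ → alternating-avoids (λ ()) (λ ()) (λ ()) p
          1 p _ → alternating-avoids (λ ()) (λ ()) (λ ()) p
          2 p _ → alternating-avoids (λ ()) (λ ()) (λ ()) p
          (suc (suc (suc i))) p _ → alternating-avoids (λ ()) (λ ()) (λ ()) p
      ; edge≢copyʳ = λ where
          0 p _ → alternating-avoids (λ ()) (λ ()) (λ ()) p
          1 p _ → alternating-avoids (λ ()) (λ ()) (λ ()) p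
          2 p _ → alternating-avoids (λ ()) (λ ()) (λ ()) p
          (suc (suc (suc i))) p _ → alternating-avoids (λ ()) (λ ()) (λ ()) p
      ; consecutive = λ where
          0 → alternating-consecutive (λ ()) (λ ())
          1 → alternating-consecutive (λ ()) (λ ())
          2 → alternating-consecutive (λ ()) (λ ())
          (suc (suc (suc i))) → alternating-consecutive (λ ()) (λ ())
      ; closing = λ where
          0 → alternating-closing 2<t (λ ()) (λ ())
          1 → alternating-closing 2<t (λ ()) (λ ())
          2 → alternating-closing 2<t (λ ()) (λ ())
          (suc (suc (suc i))) → alternating-closing 2<t (λ ()) (λ ())
      }

    private
      b₀ : 1 < 4 + m
      b₀ = m≤m+n 2 _
      b₁ : 2 < 4 + m
      b₁ = m≤m+n 3 _
      b₂ : 3 < 4 + m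
      b₂ = m≤m+n 4 _

    bVertices : ∀ i → ∃ (BVertex G colouring i)
    bVertices zero = edgeVertex 0 b₀ , refl , λ where
      zero i≢i → contradiction refl i≢i
      (suc zero) _ → edge-sees-vertex b₀ left
      (suc (suc zero)) _ → edge-sees-copy b₀ left 0<t
      (suc (suc (suc zero))) _ → edge-sees-copy b₀ left 1<t
      (suc (suc (suc (suc zero)))) _ → edge-sees-copy b₀ left 2<t
    bVertices (suc zero) = edgeVertex 1 b₁ , refl , λ where
      zero _ → edge-sees-copy b₁ right 0<t
      (suc zero) i≢i → contradiction refl i≢i
      (suc (suc zero)) _ → edge-sees-copy b₁ left 0<t
      (suc (suc (suc zero))) _ → edge-sees-copy b₁ left 1<t
      (suc (suc (suc (suc zero)))) _ → edge-sees-copy b₁ left 2<t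
    bVertices (suc (suc zero)) = edgeVertex 2 b₂ , refl , λ where
      zero _ → edge-sees-copy b₂ left 0<t
      (suc zero) _ → edge-sees-vertex b₂ right
      (suc (suc zero)) i≢i → contradiction refl i≢i
      (suc (suc (suc zero))) _ → edge-sees-copy b₂ left 2<t
      (suc (suc (suc (suc zero)))) _ → edge-sees-copy b₂ left 1<t
    bVertices (suc (suc (suc zero))) = copyVertex 1 1 b₀ 1<t , copy-colour 1 1 b₀ 1<t , λ where
      zero _ → copy-sees-edge b₀ 1<t b₀ right
      (suc zero) _ → copy-sees-edge b₀ 1<t b₁ left
      (suc (suc zero)) _ → copy-sees-previous b₀ 1<t
      (suc (suc (suc zero))) i≢i → contradiction refl i≢i
      (suc (suc (suc (suc zero)))) _ → copy-sees-next b₀ 1<t 2<t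
    bVertices (suc (suc (suc (suc zero)))) = copyVertex 2 1 b₁ 1<t , copy-colour 2 1 b₁ 1<t , λ where
      zero _ → copy-sees-previous b₁ 1<t
      (suc zero) _ → copy-sees-edge b₁ 1<t b₁ right
      (suc (suc zero)) _ → copy-sees-edge b₁ 1<t b₂ left
      (suc (suc (suc zero))) _ → copy-sees-next b₁ 1<t 2<t
      (suc (suc (suc (suc zero)))) i≢i → contradiction refl i≢i

    hasColouring : HasBChromaticColoring (path (4 + m) ⊡ cycle t 2<t) 5
    hasColouring = colouring , (λ {v} {w} → Compatible.proper compatible {v} {w}) , bVertices

  module ThreeVertices where

    -- Both edges meet the middle vertex, so every vertex of its copy sees colours 0 and 1. The two
    -- end vertices show each edge the colour of the other.
    edgeC vertexC : ℕ → Fin 5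
    edgeC 0 = # 0
    edgeC _ = # 1
    vertexC 0 = # 1
    vertexC 1 = # 2
    vertexC _ = # 0
    -- The periodic part 3, 4, 3, 4, … is preceded by 2, 3, 4, 2, so that for t = 3 and for t ≥ 5 each of
    -- the three colours occurs between the other two.
    cycleC : ℕ → Fin 5
    cycleC 0 = # 2
    cycleC 1 = # 3
    cycleC 2 = # 4
    cycleC (suc (suc (suc p))) = alternating (# 2) (# 3) (# 4) p

    open Scheme {3} 2<t edgeC vertexC (λ _ → cycleC)

    cycleC-avoids : ∀ d → d ≢ # 2 → d ≢ # 3 → d ≢ # 4 → ∀ p → d ≢ cycleC p
    cycleC-avoids _ d≢2 d≢3 d≢4 0 = d≢2
    cycleC-avoids _ d≢2 d≢3 d≢4 1 = d≢3
    cycleC-avoids _ d≢2 d≢3 d≢4 2 = d≢4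
    cycleC-avoids _ d≢2 d≢3 d≢4 (suc (suc (suc p))) = alternating-avoids d≢2 d≢3 d≢4 p

    edgeC-avoids : ∀ i p → edgeC i ≢ cycleC p
    edgeC-avoids zero    = cycleC-avoids _ (λ ()) (λ ()) (λ ())
    edgeC-avoids (suc _) = cycleC-avoids _ (λ ()) (λ ()) (λ ())

    compatible : t ≢ 4 → Compatible
    compatible t≢4 = record
      { edge≢vertexˡ = λ where
          0 _ () ; 1 _ () ; (suc (suc i)) (s≤s (s≤s (s≤s ())))
      ; edge≢vertexʳ = λ where
          0 _ () ; 1 _ () ; (suc (suc i)) (s≤s (s≤s (s≤s ())))
      ; edge≢copyˡ = λ i p _ → edgeC-avoids i p
      ; edge≢copyʳ = λ i p _ → edgeC-avoids i p
      ; consecutive = λ where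
          _ 0 ()
          _ 1 ()
          _ 2 ()
          _ (suc (suc (suc p))) → alternating-consecutive (λ ()) (λ ()) p
      ; closing = λ where
          _ 0 refl _ → contradiction 2<t λ { (s≤s ()) }
          _ 1 refl _ → contradiction 2<t λ { (s≤s (s≤s ())) }
          _ 2 _ ()
          -- For t = 4 the pattern 2, 3, 4, 2 would close on equal colours.
          _ 3 refl _ → t≢4 refl
          _ (suc (suc (suc (suc p)))) _ → ≢-sym (alternating-avoids (λ ()) (λ ()) (λ ()) p)
      }

    private
      b₀ : 1 < 3
      b₀ = s≤s (s≤s z≤n)
      b₁ : 2 < 3
      b₁ = s≤s (s≤s (s≤s z≤n))

    t≡3∨3<t : t ≡ 3 ⊎ 3 < t
    t≡3∨3<t with t ≟ 3
    ... | yes t≡3 = inj₁ t≡3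
    ... | no t≢3  = inj₂ (≤∧≢⇒< 2<t (≢-sym t≢3))

    bVertexAt : ∀ p (p<t : p < t) → (∀ j → j ≢ cycleC p → j ≢ # 0 → j ≢ # 1 →
      Sees (copyVertex 1 p b₀ p<t) j) → BVertex G colouring (cycleC p) (copyVertex 1 p b₀ p<t)
    bVertexAt p p<t seesOthers = copy-colour 1 p b₀ p<t , λ where
      zero _ → copy-sees-edge b₀ p<t b₀ right
      (suc zero) _ → copy-sees-edge b₀ p<t b₁ left
      j@(suc (suc _)) j≢ → seesOthers j j≢ (λ ()) (λ ())

    bVertices : t ≢ 4 → ∀ i → ∃ (BVertex G colouring i)
    bVertices _ zero = edgeVertex 0 b₀ , refl , λ where
      zero i≢i → contradiction refl i≢i
      (suc zero) _ → edge-sees-vertex b₀ left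
      (suc (suc zero)) _ → edge-sees-copy b₀ left 0<t
      (suc (suc (suc zero))) _ → edge-sees-copy b₀ left 1<t
      (suc (suc (suc (suc zero)))) _ → edge-sees-copy b₀ left 2<t
    bVertices _ (suc zero) = edgeVertex 1 b₁ , refl , λ where
      zero _ → edge-sees-vertex b₁ right
      (suc zero) i≢i → contradiction refl i≢i
      (suc (suc zero)) _ → edge-sees-copy b₁ left 0<t
      (suc (suc (suc zero))) _ → edge-sees-copy b₁ left 1<t
      (suc (suc (suc (suc zero)))) _ → edge-sees-copy b₁ left 2<t
    -- For t = 3, position 0 lies between 3 and 4. For t ≥ 5 its last neighbour may be 3 again, so
    -- the second 2, at position 3 between 4 and 3, is taken; its successor exists because t is not
    -- 4.
    bVertices t≢4 (suc (suc zero)) with t≡3∨3<t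
    ... | inj₁ t≡3 = copyVertex 1 0 b₀ 0<t , bVertexAt 0 0<t λ where
      zero _ j≢0 _ → contradiction refl j≢0
      (suc zero) _ _ j≢1 → contradiction refl j≢1
      (suc (suc zero)) j≢j _ _ → contradiction refl j≢j
      (suc (suc (suc zero))) _ _ _ → copy-sees-next b₀ 0<t 1<t
      (suc (suc (suc (suc zero)))) _ _ _ → copy-sees-last b₀ 0<t (sym t≡3)
    ... | inj₂ 3<t = copyVertex 1 3 b₀ 3<t , bVertexAt 3 3<t λ where
      zero _ j≢0 _ → contradiction refl j≢0
      (suc zero) _ _ j≢1 → contradiction refl j≢1
      (suc (suc zero)) j≢j _ _ → contradiction refl j≢j
      (suc (suc (suc zero))) _ _ _ → copy-sees-next b₀ 3<t (≤∧≢⇒< 3<t (≢-sym t≢4))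
      (suc (suc (suc (suc zero)))) _ _ _ → copy-sees-previous b₀ 3<t
    bVertices _ (suc (suc (suc zero))) = copyVertex 1 1 b₀ 1<t , bVertexAt 1 1<t λ where
      zero _ j≢0 _ → contradiction refl j≢0
      (suc zero) _ _ j≢1 → contradiction refl j≢1
      (suc (suc zero)) _ _ _ → copy-sees-previous b₀ 1<t
      (suc (suc (suc zero))) j≢j _ _ → contradiction refl j≢j
      (suc (suc (suc (suc zero)))) _ _ _ → copy-sees-next b₀ 1<t 2<t
    bVertices _ (suc (suc (suc (suc zero)))) = copyVertex 1 2 b₀ 2<t , bVertexAt 2 2<t λ where
      zero _ j≢0 _ → contradiction refl j≢0
      (suc zero) _ _ j≢1 → contradiction refl j≢1
      (suc (suc zero)) _ _ _ → [ copy-sees-first b₀ 2<t ∘ sym , copy-sees-next b₀ 2<t ]′ t≡3∨3<t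
      (suc (suc (suc zero))) _ _ _ → copy-sees-previous b₀ 2<t
      (suc (suc (suc (suc zero)))) j≢j _ _ → contradiction refl j≢j

    hasColouring : t ≢ 4 → HasBChromaticColoring (path 3 ⊡ cycle t 2<t) 5
    hasColouring t≢4 =
      colouring , (λ {v} {w} → Compatible.proper (compatible t≢4) {v} {w}) , bVertices t≢4

-- Four colours for three path vertices and the 4-cycle.

module FourCycle (2<4 : 2 < 4) where

  edgeC vertexC : ℕ → Fin 4
  edgeC 0 = # 0
  edgeC _ = # 1
  vertexC 0 = # 1
  vertexC 1 = # 2
  vertexC _ = # 0
  cycleC : ℕ → Fin 4
  cycleC = alternating (# 2) (# 3) (# 2)

  open Scheme {3} 2<4 edgeC vertexC (λ _ → cycleC)

  edgeC-avoids : ∀ i p → edgeC i ≢ cycleC p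
  edgeC-avoids zero    = alternating-avoids (λ ()) (λ ()) (λ ())
  edgeC-avoids (suc _) = alternating-avoids (λ ()) (λ ()) (λ ())

  compatible : Compatible
  compatible = record
    { edge≢vertexˡ = λ where
        0 _ () ; 1 _ () ; (suc (suc i)) (s≤s (s≤s (s≤s ())))
    ; edge≢vertexʳ = λ where
        0 _ () ; 1 _ () ; (suc (suc i)) (s≤s (s≤s (s≤s ())))
    ; edge≢copyˡ = λ i p _ → edgeC-avoids i p
    ; edge≢copyʳ = λ i p _ → edgeC-avoids i p
    ; consecutive = λ _ → alternating-consecutive (λ ()) (λ ())
    ; closing = λ { _ _ refl () }
    }

  private
    b₀ : 1 < 3
    b₀ = s≤s (s≤s z≤n)
    b₁ : 2 < 3
    b₁ = s≤s (s≤s (s≤s z≤n))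
    0<4 : 0 < 4
    0<4 = z<s
    1<4 : 1 < 4
    1<4 = s≤s z<s

  bVertices : ∀ i → ∃ (BVertex G colouring i)
  bVertices zero = edgeVertex 0 b₀ , refl , λ where
    zero i≢i → contradiction refl i≢i
    (suc zero) _ → edge-sees-vertex b₀ left
    (suc (suc zero)) _ → edge-sees-copy b₀ left 0<4
    (suc (suc (suc zero))) _ → edge-sees-copy b₀ left 1<4
  bVertices (suc zero) = edgeVertex 1 b₁ , refl , λ where
    zero _ → edge-sees-vertex b₁ right
    (suc zero) i≢i → contradiction refl i≢i
    (suc (suc zero)) _ → edge-sees-copy b₁ left 0<4
    (suc (suc (suc zero))) _ → edge-sees-copy b₁ left 1<4
  bVertices (suc (suc zero)) = copyVertex 1 0 b₀ 0<4 , refl , λ where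
    zero _ → copy-sees-edge b₀ 0<4 b₀ right
    (suc zero) _ → copy-sees-edge b₀ 0<4 b₁ left
    (suc (suc zero)) i≢i → contradiction refl i≢i
    (suc (suc (suc zero))) _ → copy-sees-next b₀ 0<4 1<4
  bVertices (suc (suc (suc zero))) = copyVertex 1 1 b₀ 1<4 , refl , λ where
    zero _ → copy-sees-edge b₀ 1<4 b₀ right
    (suc zero) _ → copy-sees-edge b₀ 1<4 b₁ left
    (suc (suc zero)) _ → copy-sees-previous b₀ 1<4
    (suc (suc (suc zero))) i≢i → contradiction refl i≢i

  hasColouring : HasBChromaticColoring (path 3 ⊡ cycle 4 2<4) 4
  hasColouring = colouring , (λ {v} {w} → Compatible.proper compatible {v} {w}) , bVertices

-- A walk through the indices below h that never returns to 0.

module Bounce (h : ℕ) (2<h : 2 < h) where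

  step : ℕ → ℕ
  step r with suc r <? h
  ... | yes _ = suc r
  ... | no  _ = pred r

  -- 0, 1, …, h ∸ 1, h ∸ 2, h ∸ 1, h ∸ 2, …
  bounce : ℕ → ℕ
  bounce zero    = 0
  bounce (suc p) = step (bounce p)

  step-< : ∀ {r} → r < h → step r < h
  step-< {r} r<h with suc r <? h
  ... | yes r+1<h = r+1<h
  ... | no _      = ≤-<-trans pred[n]≤n r<h

  step-≢ : ∀ r → r ≢ step r
  step-≢ r eq with suc r <? h
  ... | yes _ = contradiction (sym eq) 1+n≢n
  step-≢ zero    eq | no 1≮h = 1≮h (<⇒≤ 2<h)
  step-≢ (suc r) eq | no _   = contradiction eq 1+n≢n

  -- A downward step starts at h - 1 or above, hence at 2 or more because h > 2. So 0 occurs only at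
  -- the start and cycles of any length close properly.
  step-> : ∀ r → 0 < step r
  step-> r with suc r <? h
  ... | yes _ = z<s
  step-> zero          | no 1≮h = contradiction (<⇒≤ 2<h) 1≮h
  step-> (suc zero)    | no 2≮h = contradiction 2<h 2≮h
  step-> (suc (suc r)) | no _   = z<s

  bounce-< : ∀ p → bounce p < h
  bounce-< zero    = ≤-trans z<s 2<h
  bounce-< (suc p) = step-< (bounce-< p)

  -- The first h positions run through all h indices; with h ≤ t + 1 they fit into a block.
  bounce-id : ∀ {p} → p < h → bounce p ≡ p
  bounce-id {zero}  _     = refl
  bounce-id {suc p} p+1<h rewrite bounce-id (<⇒≤ p+1<h) with suc p <? h
  ... | yes _     = refl
  ... | no p+1≮h  = contradiction p+1<h p+1≮h

  bounce-closing : ∀ {t p} → 2 < t → suc p ≡ t → bounce p ≢ 0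
  bounce-closing {p = zero}  2<t refl _  = contradiction 2<t λ { (s≤s ()) }
  bounce-closing {p = suc p} _   _    eq = <⇒≢ (step-> (bounce p)) (sym eq)

-- Parity and rotation of residues.

halve : ∀ m → ∃[ r ] (m ≡ 2 * r ⊎ m ≡ 1 + 2 * r)
halve zero = 0 , inj₁ refl
halve (suc m) with halve m
... | r , inj₁ eq = r , inj₂ (cong suc eq)
... | r , inj₂ eq = suc r , inj₁ (trans (cong suc eq) (sym (*-suc 2 r)))

module _ (l : ℕ) where

  private
    K : ℕ
    K = suc l

  -- As `l` is -1 modulo `suc l`, adding `l * i` undoes the shift by `i`.
  shift-cancel : ∀ i {x} → x < K → ((i + x) % K + (l * i) % K) % K ≡ x
  shift-cancel i {x} x<K = begin
    ((i + x) % K + (l * i) % K) % K ≡⟨ %-distribˡ-+ (i + x) (l * i) K ⟨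
    (i + x + l * i) % K             ≡⟨ cong (_% K) (rearrange i x l) ⟩
    (x + i * K) % K                 ≡⟨ [m+kn]%n≡m%n x i K ⟩
    x % K                           ≡⟨ m<n⇒m%n≡m x<K ⟩
    x                               ∎
    where
    open ≡-Reasoning
    rearrange : ∀ i x l → i + x + l * i ≡ x + i * suc l
    rearrange = solve-∀

  shift-injective : ∀ i {x y} → x < K → y < K → (i + x) % K ≡ (i + y) % K → x ≡ y
  shift-injective i x<K y<K eq = trans (sym (shift-cancel i x<K))
    (trans (cong (λ z → (z + (l * i) % K) % K) eq) (shift-cancel i y<K))

  rotation : ∀ {i j} → i < K → j < K → i ≢ j → ∃[ d ] (d < l × (i + suc d) % K ≡ j)
  rotation {i} {j} i<K j<K i≢j with <-cmp i j
  ... | tri≈ _ i≡j _ = contradiction i≡j i≢j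
  ... | tri< i<j _ _ with m≤n⇒∃[o]m+o≡n i<j
  ...   | d , refl = d , ≤-trans (s≤s (m≤n+m d i)) (s≤s⁻¹ j<K) ,
          trans (cong (_% K) (+-suc i d)) (m<n⇒m%n≡m j<K)
  rotation {i} {j} i<K j<K i≢j | tri> _ _ j<i with m≤n⇒∃[o]m+o≡n (s≤s⁻¹ i<K) | m≤n⇒∃[o]m+o≡n j<i
  -- Here e = l - i, so `suc (e + j)` is K - i + j and the sum is j + K.
  ...   | e , refl | f , refl = e + j ,
          ≤-trans (≤-reflexive (+-comm (suc e) j)) (≤-trans (≤-reflexive (+-suc j e)) (+-monoˡ-≤ e (m≤m+n (suc j) f))) ,
          trans (cong (_% K) (rearrange j f e)) (trans ([m+n]%n≡m%n j K) (m<n⇒m%n≡m j<K))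
    where
    rearrange : ∀ j f e → suc j + f + suc (e + j) ≡ j + suc (suc j + f + e)
    rearrange = solve-∀

-- The rotating colouring with k = 2h + 1 or k = 2h colours.

module LongPath {n t h k′ : ℕ} (2<t : 2 < t) (2<h : 2 < h) (h≤1+t : h ≤ suc t)
  (k<n : suc k′ < n) (2h≤k : 2 * h ≤ suc k′)
  (k-exact : suc k′ ≡ suc (2 * h) ⊎ suc (suc k′) ≡ n) (k≤K : suc k′ ≤ suc (2 * h)) where

  open Bounce h 2<h

  private
    k K : ℕ
    k = suc k′
    K = suc (2 * h)

  residue : ℕ → ℕ → ℕ
  residue i x = (i + x) % K

  InRange : ℕ → ℕ → Set
  InRange i x = residue i x < k

  -- Reduction modulo `k` only lands the value in `Fin k`; for residues in range it changes nothing.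
  colour : ℕ → ℕ → Fin k
  colour i x = residue i x mod k

  colour-residue : ∀ i x → InRange i x → toℕ (colour i x) ≡ residue i x
  colour-residue _ _ r<k = trans (toℕ-fromℕ< _) (m<n⇒m%n≡m r<k)

  colour-injective : ∀ i {x y} → x < K → y < K → InRange i x → InRange i y →
    colour i x ≡ colour i y → x ≡ y
  colour-injective i {x} {y} x<K y<K rx ry eq = shift-injective (2 * h) i x<K y<K
    (trans (sym (colour-residue i x rx)) (trans (cong toℕ eq) (colour-residue i y ry)))

  -- Since 2h ≤ k, the largest residue 2h is the only one that can fail to be a colour. Hence each
  -- block has at most one excluded offset.
  excluded-residue : ∀ i x → ¬ InRange i x → residue i x ≡ 2 * h
  excluded-residue i x r≮k =
    ≤-antisym (s≤s⁻¹ (m%n<n (i + x) K)) (≤-trans 2h≤k (≮⇒≥ r≮k))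

  excluded-unique : ∀ i {x y} → x < K → y < K → ¬ InRange i x → ¬ InRange i y → x ≡ y
  excluded-unique i {x} {y} x<K y<K rx ry =
    shift-injective (2 * h) i x<K y<K (trans (excluded-residue i x rx) (sym (excluded-residue i y ry)))

  odd< : ∀ {r} → r < h → 1 + 2 * r < 2 * h
  odd< {r} r<h = ≤-trans (≤-reflexive (sym (*-suc 2 r))) (*-monoʳ-≤ 2 r<h)

  2<2h : 2 < 2 * h
  2<2h = ≤-trans 2<h (m≤m+n h _)

  1+2r≢2 : ∀ r → 1 + 2 * r ≢ 2
  1+2r≢2 r eq = even≢odd 1 r (sym eq)

  -- The offsets 0 and 2h are avoided: relative to block i they give the colours of e_i and e_{i-1}.
  -- The substitute 2 is even, so it differs from all odd offsets.
  offset : ℕ → ℕ → ℕ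
  offset i r with residue i (1 + 2 * r) <? k
  ... | yes _ = 1 + 2 * r
  ... | no  _ = 2

  offset->0 : ∀ i r → 0 < offset i r
  offset->0 i r with residue i (1 + 2 * r) <? k
  ... | yes _ = z<s
  ... | no  _ = z<s

  offset-<2h : ∀ i {r} → r < h → offset i r < 2 * h
  offset-<2h i {r} r<h with residue i (1 + 2 * r) <? k
  ... | yes _ = odd< r<h
  ... | no  _ = 2<2h

  offset-<K : ∀ i {r} → r < h → offset i r < K
  offset-<K i r<h = m<n⇒m<1+n (offset-<2h i r<h)

  offset-inRange : ∀ i {r} → r < h → InRange i (offset i r)
  offset-inRange i {r} r<h with residue i (1 + 2 * r) <? k
  ... | yes in-range = in-range
  ... | no r≮k with residue i 2 <? k
  ...   | yes in-range = in-range
  -- Two excluded offsets would coincide, but one is odd and the other is 2.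
  ...   | no 2≮k = contradiction
    (excluded-unique i (m<n⇒m<1+n (odd< r<h)) (m<n⇒m<1+n 2<2h) r≮k 2≮k) (1+2r≢2 r)

  -- Only one odd offset can be excluded, so two replaced indices agree; a replaced and an
  -- unreplaced one differ in parity.
  offset-injective : ∀ i {r s} → r < h → s < h → offset i r ≡ offset i s → r ≡ s
  offset-injective i {r} {s} r<h s<h eq
    with residue i (1 + 2 * r) <? k | residue i (1 + 2 * s) <? k
  ... | yes _ | yes _ = *-cancelˡ-≡ r s 2 (suc-injective eq)
  ... | yes _ | no  _ = contradiction eq (1+2r≢2 r)
  ... | no  _ | yes _ = contradiction (sym eq) (1+2r≢2 s)
  ... | no r≮k | no s≮k = *-cancelˡ-≡ r s 2 (suc-injective
    (excluded-unique i (m<n⇒m<1+n (odd< r<h)) (m<n⇒m<1+n (odd< s<h)) r≮k s≮k))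

  offset-odd : ∀ i {r} → InRange i (1 + 2 * r) → offset i r ≡ 1 + 2 * r
  offset-odd i {r} in-range with residue i (1 + 2 * r) <? k
  ... | yes _  = refl
  ... | no r≮k = contradiction in-range r≮k

  edgeC : ℕ → Fin k
  edgeC i = colour i 0

  blockC : ℕ → ℕ → Fin k
  blockC i p = colour i (offset i (bounce p))

  -- The vertex u_i takes position `t` of its block, following the cycle positions 0 to t - 1.
  open Scheme {n} 2<t edgeC (λ i → blockC i t) blockC

  -- If k = K, every residue is a colour. If k + 1 = n, an edge has i < k and its residue is i
  -- itself.
  edge-inRange : ∀ {i} → suc i < n → InRange i 0
  edge-inRange {i} i+1<n =
    [ (λ k≡K → subst (residue i 0 <_) (sym k≡K) (m%n<n (i + 0) K))
    , (λ 1+k≡n → below (s≤s⁻¹ (subst (suc i <_) (sym 1+k≡n) i+1<n))) ]′ k-exact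
    where
    below : i < k → InRange i 0
    below i<k = subst (_< k)
      (sym (trans (cong (_% K) (+-identityʳ i)) (m<n⇒m%n≡m (≤-trans i<k k≤K)))) i<k

  -- As (i + 1) + 2h = i + K, edge i has offset 2h as seen from block i + 1. This reduces
  -- `edge≢blockʳ` to offsets staying below 2h.
  wrap : ∀ i → residue (suc i) (2 * h) ≡ residue i 0
  wrap i = trans (cong (_% K) (sym (+-suc i (2 * h))))
    (trans ([m+n]%n≡m%n i K) (cong (_% K) (sym (+-identityʳ i))))

  edge≢blockˡ : ∀ i p → suc i < n → edgeC i ≢ blockC i p
  edge≢blockˡ i p b eq = <⇒≢ (offset->0 i (bounce p))
    (colour-injective i z<s (offset-<K i (bounce-< p)) (edge-inRange b) (offset-inRange i (bounce-< p)) eq)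

  edge≢blockʳ : ∀ i p → suc i < n → edgeC i ≢ blockC (suc i) p
  edge≢blockʳ i p b eq = <⇒≢ (offset-<2h (suc i) (bounce-< p))
    (colour-injective (suc i) (offset-<K (suc i) (bounce-< p)) ≤-refl (offset-inRange (suc i) (bounce-< p))
      (subst (_< k) (sym (wrap i)) (edge-inRange b))
      (trans (sym eq) (cong (_mod k) (sym (wrap i)))))

  block-injective : ∀ i p q → blockC i p ≡ blockC i q → bounce p ≡ bounce q
  block-injective i p q eq = offset-injective i (bounce-< p) (bounce-< q)
    (colour-injective i (offset-<K i (bounce-< p)) (offset-<K i (bounce-< q))
      (offset-inRange i (bounce-< p)) (offset-inRange i (bounce-< q)) eq)

  compatible : Compatible
  compatible = record
    { edge≢vertexˡ = λ i → edge≢blockˡ i t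
    ; edge≢vertexʳ = λ i → edge≢blockʳ i t
    ; edge≢copyˡ   = edge≢blockˡ
    ; edge≢copyʳ   = edge≢blockʳ
    ; consecutive  = λ i p eq → step-≢ (bounce p) (block-injective i p (suc p) eq)
    ; closing      = λ i p last eq → bounce-closing 2<t last (block-injective i p 0 eq)
    }

  edge-sees-block : ∀ {i x p j} b → x ≡ i ⊎ x ≡ suc i → p ≤ t → blockC x p ≡ j → Sees (edgeVertex i b) j
  edge-sees-block b x∈i p≤t refl with m≤n⇒m<n∨m≡n p≤t
  ... | inj₁ p<t  = edge-sees-copy b x∈i p<t
  ... | inj₂ refl = edge-sees-vertex b x∈i

  -- The residue is the value of an actual colour, hence in range, so the odd offset was not
  -- replaced: substitution loses no colour that an edge has to see.
  block-odd : ∀ i {r} → r < h → {j : Fin k} → residue i (1 + 2 * r) ≡ toℕ j → blockC i r ≡ j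
  block-odd i {r} r<h {j} eq = toℕ-injective (begin
    toℕ (colour i (offset i (bounce r))) ≡⟨ colour-residue i _ (offset-inRange i (bounce-< r)) ⟩
    residue i (offset i (bounce r))      ≡⟨ cong (residue i ∘ offset i) (bounce-id r<h) ⟩
    residue i (offset i r)               ≡⟨ cong (residue i) (offset-odd i (subst (_< k) (sym eq) (toℕ<n j))) ⟩
    residue i (1 + 2 * r)                ≡⟨ eq ⟩
    toℕ j                                ∎)
    where open ≡-Reasoning

  bVertices : ∀ i → ∃ (BVertex G colouring i)
  bVertices i = edgeVertex (toℕ i) b , own-colour , sees
    where
    b : suc (toℕ i) < n
    b = ≤-<-trans (toℕ<n i) k<n
    toℕ<K : ∀ (j : Fin k) → toℕ j < K
    toℕ<K j = ≤-trans (toℕ<n j) k≤K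
    own-colour : colouring (edgeVertex (toℕ i) b) ≡ i
    own-colour = trans (edge-colour _ b) (toℕ-injective (trans (colour-residue (toℕ i) 0 (edge-inRange b))
      (trans (cong (_% K) (+-identityʳ (toℕ i))) (m<n⇒m%n≡m (toℕ<K i)))))
    sees : ∀ j → j ≢ i → Sees (edgeVertex (toℕ i) b) j
    sees j j≢i with rotation (2 * h) (toℕ<K i) (toℕ<K j) (j≢i ∘ sym ∘ toℕ-injective)
    -- Colour `j` has offset `suc d` from edge `i`. For d = 2r this is the odd offset 1 + 2r of
    -- block i; for d = 1 + 2r it is 2 + 2r, which is the odd offset 1 + 2r of block i + 1.
    ... | d , d<2h , eq with halve d
    ...   | r , inj₁ refl = edge-sees-block b (inj₁ refl) (s≤s⁻¹ (≤-trans r<h h≤1+t)) (block-odd (toℕ i) r<h eq)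
      where r<h = *-cancelˡ-< 2 r h d<2h
    ...   | r , inj₂ refl = edge-sees-block b (inj₂ refl) (s≤s⁻¹ (≤-trans r<h h≤1+t))
        (block-odd (suc (toℕ i)) r<h (trans (cong (_% K) (sym (+-suc (toℕ i) (1 + 2 * r)))) eq))
      where r<h = *-cancelˡ-< 2 r h (<⇒≤ d<2h)

  hasColouring : HasBChromaticColoring (path n ⊡ cycle t 2<t) k
  hasColouring = colouring , (λ {v} {w} → Compatible.proper compatible {v} {w}) , bVertices

-- Taking h as half of `k`, rounded down, makes K equal to k for odd k and to k + 1 for even k; 6 ≤
-- k gives h > 2.
longPath : ∀ {n t} (2<t : 2 < t) k → 6 ≤ k → k < n → k ≡ 2 * t + 3 ⊎ (suc k ≡ n × k ≤ 2 * t + 3) →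
  HasBChromaticColoring (path n ⊡ cycle t 2<t) k
longPath {n} {t} 2<t k@(suc k′) 6≤k k<n bound with halve k
... | h , half = LongPath.hasColouring 2<t
  (*-cancelˡ-< 2 2 h (s≤s⁻¹ (≤-trans 6≤k k≤K))) (*-cancelˡ-≤ 2 2h≤) k<n 2h≤k (exact half bound) k≤K
  where
  k≤K : k ≤ suc (2 * h)
  k≤K = [ (λ eq → m≤n⇒m≤1+n (≤-reflexive eq)) , ≤-reflexive ]′ half
  2h≤k : 2 * h ≤ k
  2h≤k = [ (λ eq → ≤-reflexive (sym eq)) , (λ eq → ≤-trans (n≤1+n _) (≤-reflexive (sym eq))) ]′ half
  2t+3 : ∀ t → 2 * t + 3 ≡ 1 + 2 * suc t
  2t+3 = solve-∀
  k≤2t+3 : k ≤ 1 + 2 * suc t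
  k≤2t+3 = ≤-trans ([ ≤-reflexive , proj₂ ]′ bound) (≤-reflexive (2t+3 t))
  2h≤ : 2 * h ≤ 2 * suc t
  -- An even number at most 2t + 3 is at most 2t + 2.
  2h≤ with m≤n⇒m<n∨m≡n (≤-trans 2h≤k k≤2t+3)
  ... | inj₁ lt = s≤s⁻¹ lt
  ... | inj₂ eq = contradiction eq (even≢odd h (suc t))
  exact : k ≡ 2 * h ⊎ k ≡ 1 + 2 * h → k ≡ 2 * t + 3 ⊎ (suc k ≡ n × k ≤ 2 * t + 3) →
    k ≡ suc (2 * h) ⊎ suc k ≡ n
  exact (inj₂ odd)  _                  = inj₁ odd
  exact (inj₁ even) (inj₁ k≡2t+3)      =
    contradiction (trans (sym even) (trans k≡2t+3 (2t+3 t))) (even≢odd h (suc t))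
  exact (inj₁ _)    (inj₂ (1+k≡n , _)) = inj₂ 1+k≡n

theorem7 : (n t : ℕ) → 2 < n → (2<t : 2 < t) →
    φ (path n ⊡ cycle t 2<t) ≐
    (if ⌊ (n ≟ 3) ×-dec (t ≟ 4) ⌋ then 4
    else if ⌊ ((n ≟ 3) ×-dec ¬? (t ≟ 4)) ⊎-dec ((n ≟ 4) ⊎-dec (n ≟ 5)) ⌋ then 5
    else if ⌊ (6 ≤? n) ×-dec (n ≤? 2 * t + 3) ⌋ then n ∸ 1
    else 2 * t + 3)
theorem7 1 t (s≤s ()) 2<t
theorem7 2 t (s≤s (s≤s ())) 2<t
theorem7 3 t _ 2<t with t ≟ 4
... | yes refl = FourCycle.hasColouring 2<t , φ-upper-3-4
... | no t≢4   = ThreeVertices.hasColouring 2<t t≢4 ,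
  λ l H → [ (λ l≤5 → l≤5) , (λ (l≤2 , _) → ≤-trans l≤2 (m≤m+n 2 3)) ]′ (φ-upper l H)
theorem7 4 t _ 2<t = FiveColours.hasColouring 2<t 0 ,
  λ l H → [ (λ l≤5 → l≤5) , (λ (l≤3 , _) → ≤-trans l≤3 (m≤m+n 3 2)) ]′ (φ-upper l H)
theorem7 5 t _ 2<t = FiveColours.hasColouring 2<t 1 ,
  λ l H → [ (λ l≤5 → l≤5) , (λ (l≤4 , _) → ≤-trans l≤4 (m≤m+n 4 1)) ]′ (φ-upper l H)
theorem7 n@(suc (suc (suc (suc (suc (suc m)))))) t _ 2<t with n ≤? 2 * t + 3
... | yes n≤ = lower m n≤ ,
  λ l H → [ (λ l≤5 → ≤-trans l≤5 (m≤m+n 5 m)) , proj₁ ]′ (φ-upper l H)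
  where
  lower : ∀ m → 6 + m ≤ 2 * t + 3 → HasBChromaticColoring (path (6 + m) ⊡ cycle t 2<t) (5 + m)
  -- For n = 6 the value is 5, where halving would give only h = 2; the explicit colouring takes
  -- over.
  lower zero    _  = FiveColours.hasColouring 2<t 2
  lower (suc m) n≤ = longPath 2<t (6 + m) (m≤m+n 6 m) ≤-refl (inj₂ (refl , <⇒≤ n≤))
... | no n≰ = longPath 2<t (2 * t + 3) (≤-trans (m≤m+n 6 3) 9≤2t+3) (≰⇒> n≰) (inj₁ refl) ,
  λ l H → [ (λ l≤5 → ≤-trans l≤5 (≤-trans (m≤m+n 5 4) 9≤2t+3)) , proj₂ ]′ (φ-upper l H)
  where
  9≤2t+3 : 9 ≤ 2 * t + 3
  9≤2t+3 = +-monoˡ-≤ 3 (*-monoʳ-≤ 2 2<t)
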